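{- For every integer $n\ge 2$, the chromatic number of $H_2(n,n-1)$ equals $4$.
   Context: For $x,y\in\mathbb{Z}_2^n$, $\mathrm{d}(x,y)=|\{i: x_i\neq y_i\}|$ is the Hamming distance. $H_2(n,n-1)$ is the simple undirected graph with vertex set $\mathbb{Z}_2^n$ in which $x,y$ are adjacent iff $\mathrm{d}(x,y)\ge n-1$. -}

module Defs where

open import Data.Fin using (Fin; _≟_)
open import Data.Nat using (ℕ; suc; _≤_; _<_; _≥_; _∸_)
open import Data.Nat.Properties using (<⇒≱; m<n⇒0<n∸m)
open import Data.Product using (_×_; Σ-syntax)
open import Data.Vec using (Vec; []; _∷_; lookup; count; allFin)
open import Function using (_∘_)
open import Relation.Binary.Definitions using (Symmetric; Irreflexive)
open import Relation.Binary.PropositionalEquality using (_≡_; _≢_; refl; sym; cong; subst)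
open import Relation.Nullary using (¬_; yes; no; contradiction)
open import Relation.Nullary.Decidable using (¬?)
open import Relation.Unary using (Decidable)

record SimpleGraph : Set₁ where
  field
    Vertex  : Set
    Adj     : Vertex → Vertex → Set
    symm    : Symmetric Adj
    irrefl  : Irreflexive _≡_ Adj

IsProperColouring : (G : SimpleGraph) {C : Set} → (SimpleGraph.Vertex G → C) → Set
IsProperColouring G c = ∀ x y → Adj x y → c x ≢ c y
  where open SimpleGraph G

Colourable : SimpleGraph → ℕ → Set
Colourable G k = Σ[ c ∈ (SimpleGraph.Vertex G → Fin k) ] IsProperColouring G c

IsChromaticNumber : SimpleGraph → ℕ → Set
IsChromaticNumber G k = Colourable G k × (∀ m → Colourable G m → k ≤ m)

ℤ₂^ : ℕ → Set
ℤ₂^ n = Vec (Fin 2) n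

d : ∀ {n} → ℤ₂^ n → ℤ₂^ n → ℕ
d {n} x y = count (λ i → ¬? (lookup x i ≟ lookup y i)) (allFin n)

private
  count-none : ∀ {A : Set} {P : A → Set} (P? : Decidable P) →
               (∀ a → ¬ P a) → ∀ {n} (as : Vec A n) → count P? as ≡ 0
  count-none P? none [] = refl
  count-none P? none (a ∷ as) with P? a
  ... | yes p = contradiction p (none a)
  ... | no  _ = count-none P? none as

  count-cong : ∀ {A : Set} {P Q : A → Set} (P? : Decidable P) (Q? : Decidable Q) →
               (∀ {a} → P a → Q a) → (∀ {a} → Q a → P a) →
               ∀ {n} (as : Vec A n) → count P? as ≡ count Q? as
  count-cong P? Q? f g [] = refl
  count-cong P? Q? f g (a ∷ as) with P? a | Q? a
  ... | yes _ | yes _ = cong suc (count-cong P? Q? f g as)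
  ... | no  _ | no  _ = count-cong P? Q? f g as
  ... | yes p | no ¬q = contradiction (f p) ¬q
  ... | no ¬p | yes q = contradiction (g q) ¬p

d-self : ∀ {n} (x : ℤ₂^ n) → d x x ≡ 0
d-self {n} x = count-none _ (λ _ x≢x → x≢x refl) (allFin n)

d-sym : ∀ {n} (x y : ℤ₂^ n) → d x y ≡ d y x
d-sym {n} x y = count-cong _ _ (_∘ sym) (_∘ sym) (allFin n)

-- Positivity of k is what makes the graph loopless.
H₂ : (n k : ℕ) → 0 < k → SimpleGraph
H₂ n k 0<k = record
  { Vertex = ℤ₂^ n
  ; Adj    = λ x y → d x y ≥ k
  ; symm   = λ {x} {y} → subst (k ≤_) (d-sym x y)
  ; irrefl = λ { {x} refl k≤d → <⇒≱ 0<k (subst (k ≤_) (d-self x) k≤d) }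
  }

n∸1-positive : ∀ {n} → n ≥ 2 → 0 < n ∸ 1
n∸1-positive = m<n⇒0<n∸m

{-# OPTIONS --safe #-}
-- Two vertices sharing their first two coordinates are at distance at most
-- n − 2, so these coordinates give a proper 4-colouring.
--
-- Conversely, orient every edge of a properly 3-coloured graph by the cyclic
-- order of the three colours.  The two halves of a 4-cycle then have the same
-- number of ascents, so the number of ascents of a walk whose steps are
-- commuting involutions depends only on the multiset of its steps, and in
-- particular is unchanged when these are performed in reverse order.  If the
-- walk is closed, performing them in reverse order retraces it backwards and
-- exchanges ascents and descents; hence a closed walk of this kind has as many
-- descents as ascents, and even length.  In H₂(n, n−1) the n steps flipping all
-- coordinates but one form a closed walk when n is odd; when n is even, one
-- more step flipping all coordinates closes it.  Either length is odd.
module Submission where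

open import Data.Fin using (Fin; zero; suc; _≟_; opposite; combine; inject≤)
open import Data.Fin.Properties using (all?; combine-injective; inject≤-injective; opposite-involutive)
open import Data.List using (List; []; _∷_; _++_; [_]; length; reverse; allFin) renaming (map to mapᴸ; tabulate to tabulateᴸ)
open import Data.List.Properties using (length-map; length-tabulate; map-tabulate; unfold-reverse)
open import Data.List.Relation.Binary.Permutation.Propositional using (_↭_; refl; prep; swap; trans; ↭-sym)
open import Data.List.Relation.Binary.Permutation.Propositional.Properties using (↭-reverse)
open import Data.Maybe using (Maybe; just; nothing)
open import Data.Nat using (ℕ; zero; suc; _+_; _*_; _∸_; _≤_; _≥_; z≤n; s≤s; s≤s⁻¹)
import Data.Nat as ℕ
open import Data.Nat.Properties using (≤-reflexive; ≤-trans; m≤n⇒m≤1+n; m∸n≤m; ≮⇒≥; 1+n≰n; +-suc; +-assoc; +-identityʳ; even≢odd)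
open import Data.Nat.Solver using (module +-*-Solver)
open import Data.Product using (_,_; ∃)
open import Data.Sum using (_⊎_; inj₁; inj₂)
open import Data.Vec using ([]; _∷_; lookup; count; tabulate; map; replicate)
open import Data.Vec.Properties using (map-id; map-cong)
open import Function using (_∘_; id)
open import Relation.Binary.PropositionalEquality using (_≡_; _≢_; refl; sym; cong; cong₂; subst; module ≡-Reasoning) renaming (trans to ≡-trans)
open import Relation.Nullary using (¬_; yes; no; contradiction)
open import Relation.Nullary.Decidable using (¬?; _→-dec_; toSum; toWitness)
open import Relation.Unary using (Decidable)

open import Defs

-- The cyclic order on three colours.

ascent : Fin 3 → Fin 3 → ℕ
ascent zero             (suc zero)       = 1
ascent (suc zero)       (suc (suc zero)) = 1
ascent (suc (suc zero)) zero             = 1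
ascent _                _                = 0

ascent-reverse : ∀ a b → a ≢ b → ascent a b + ascent b a ≡ 1
ascent-reverse = toWitness
  {a? = all? λ a → all? λ b → ¬? (a ≟ b) →-dec (ascent a b + ascent b a ℕ.≟ 1)} _

-- The difference of the two sides is divisible by 3 and at most 2 in absolute value.
ascent-square : ∀ a b c d → a ≢ b → b ≢ d → a ≢ c → c ≢ d →
                ascent a b + ascent b d ≡ ascent a c + ascent c d
ascent-square = toWitness
  {a? = all? λ a → all? λ b → all? λ c → all? λ d →
        ¬? (a ≟ b) →-dec (¬? (b ≟ d) →-dec (¬? (a ≟ c) →-dec (¬? (c ≟ d) →-dec
        (ascent a b + ascent b d ℕ.≟ ascent a c + ascent c d))))} _

-- Walks of commuting involutions and their ascents.

module CommutingInvolutions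
  {A I : Set} (act : I → A → A)
  (act-comm : ∀ i j x → act i (act j x) ≡ act j (act i x))
  (act-involutive : ∀ i x → act i (act i x) ≡ x)
  where

  walk : A → List I → A
  walk x []      = x
  walk x (i ∷ w) = walk (act i x) w

  walk-++ : ∀ x w v → walk x (w ++ v) ≡ walk (walk x w) v
  walk-++ x []      v = refl
  walk-++ x (i ∷ w) v = walk-++ (act i x) w v

  walk-reverse : ∀ x w → walk (walk x w) (reverse w) ≡ x
  walk-reverse x []      = refl
  walk-reverse x (i ∷ w) = begin
    walk (walk x′ w) (reverse (i ∷ w))         ≡⟨ cong (walk (walk x′ w)) (unfold-reverse i w) ⟩
    walk (walk x′ w) (reverse w ++ [ i ])      ≡⟨ walk-++ (walk x′ w) (reverse w) [ i ] ⟩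
    act i (walk (walk x′ w) (reverse w))       ≡⟨ cong (act i) (walk-reverse x′ w) ⟩
    act i x′                                   ≡⟨ act-involutive i x ⟩
    x                                          ∎
    where
    open ≡-Reasoning
    x′ = act i x

  module ThreeColouring (c : A → Fin 3) (proper : ∀ i x → c x ≢ c (act i x)) where

    step : A → I → ℕ
    step x i = ascent (c x) (c (act i x))

    ascents : A → List I → ℕ
    ascents x []      = 0
    ascents x (i ∷ w) = step x i + ascents (act i x) w

    -- By commutativity both orders of the two steps lead to the same vertex, so they are the two
    -- halves of a 4-cycle.
    step-swap : ∀ x i j → step x i + step (act i x) j ≡ step x j + step (act j x) i
    step-swap x i j rewrite act-comm j i x =
      ascent-square _ _ _ _ (proper i x) (subst (λ y → c (act i x) ≢ c y) (act-comm j i x) (proper j (act i x)))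
                            (proper j x) (proper i (act j x))

    step-back : ∀ x i → step x i + step (act i x) i ≡ 1
    step-back x i rewrite act-involutive i x = ascent-reverse _ _ (proper i x)

    -- Adjacent swaps generate all permutations; after a swap the remaining steps start from the
    -- same vertex either way.
    ascents-↭ : ∀ x {w v} → w ↭ v → ascents x w ≡ ascents x v
    ascents-↭ x refl        = refl
    ascents-↭ x (prep i p)  = cong (step x i +_) (ascents-↭ (act i x) p)
    ascents-↭ x (trans p q) = ≡-trans (ascents-↭ x p) (ascents-↭ x q)
    ascents-↭ x (swap {w} {v} i j p) = begin
      step x i + (step (act i x) j + ascents (act j (act i x)) w)  ≡⟨ +-assoc (step x i) _ _ ⟨
      step x i + step (act i x) j + ascents (act j (act i x)) w    ≡⟨ cong₂ _+_ (step-swap x i j) (≡-trans (ascents-↭ _ p) (cong (λ y → ascents y v) (act-comm j i x))) ⟩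
      step x j + step (act j x) i + ascents (act i (act j x)) v    ≡⟨ +-assoc (step x j) _ _ ⟩
      step x j + (step (act j x) i + ascents (act i (act j x)) v)  ∎
      where open ≡-Reasoning

    ascents-++ : ∀ x w v → ascents x (w ++ v) ≡ ascents x w + ascents (walk x w) v
    ascents-++ x []      v = refl
    ascents-++ x (i ∷ w) v =
      ≡-trans (cong (step x i +_) (ascents-++ (act i x) w v)) (sym (+-assoc (step x i) _ _))

    -- Going out and back crosses each edge once in either direction, and by `step-back` exactly one
    -- of these crossings ascends.
    ascents-reverse : ∀ x w → ascents x w + ascents (walk x w) (reverse w) ≡ length w
    ascents-reverse x []      = refl
    ascents-reverse x (i ∷ w) = begin
      s + u + ascents y (reverse (i ∷ w))                             ≡⟨ cong (λ v → s + u + ascents y v) (unfold-reverse i w) ⟩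
      s + u + ascents y (reverse w ++ [ i ])                          ≡⟨ cong (s + u +_) (ascents-++ y (reverse w) [ i ]) ⟩
      s + u + (r + (step (walk y (reverse w)) i + 0))                 ≡⟨ cong (λ z → s + u + (r + (step z i + 0))) (walk-reverse x′ w) ⟩
      s + u + (r + (step x′ i + 0))                                   ≡⟨ rearrange s u r (step x′ i) ⟩
      (s + step x′ i) + (u + r)                                       ≡⟨ cong₂ _+_ (step-back x i) (ascents-reverse x′ w) ⟩
      suc (length w)                                                  ∎
      where
      open ≡-Reasoning
      x′ = act i x
      y  = walk x′ w
      s  = step x i
      u  = ascents x′ w
      r  = ascents y (reverse w)
      rearrange : ∀ s u r t → s + u + (r + (t + 0)) ≡ (s + t) + (u + r)
      rearrange = solve 4 (λ s u r t → s :+ u :+ (r :+ (t :+ con 0)) := (s :+ t) :+ (u :+ r)) refl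
        where open +-*-Solver

    -- When the walk closes, the way back also starts at `x` and permutes the steps of `w`, so both
    -- summands of `ascents-reverse` are equal.
    closed-walk-even : ∀ x w → walk x w ≡ x → 2 * ascents x w ≡ length w
    closed-walk-even x w closed = begin
      2 * ascents x w                                ≡⟨ cong (ascents x w +_) (+-identityʳ _) ⟩
      ascents x w + ascents x w                      ≡⟨ cong (ascents x w +_) (ascents-↭ x (↭-sym (↭-reverse w))) ⟩
      ascents x w + ascents x (reverse w)            ≡⟨ cong (λ y → ascents x w + ascents y (reverse w)) closed ⟨
      ascents x w + ascents (walk x w) (reverse w)   ≡⟨ ascents-reverse x w ⟩
      length w                                       ∎
      where open ≡-Reasoning

-- The flips as commuting involutions of the cube.

-- flip nothing changes every coordinate, flip (just i) every one except the i-th.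
flip : ∀ {n} → Maybe (Fin n) → ℤ₂^ n → ℤ₂^ n
flip nothing        x       = map opposite x
flip (just zero)    (a ∷ x) = a ∷ flip nothing x
flip (just (suc i)) (a ∷ x) = opposite a ∷ flip (just i) x

flip-comm-all : ∀ {n} (i : Fin n) x → flip nothing (flip (just i) x) ≡ flip (just i) (flip nothing x)
flip-comm-all zero    (a ∷ x) = refl
flip-comm-all (suc i) (a ∷ x) = cong (_ ∷_) (flip-comm-all i x)

flip-comm : ∀ {n} (s t : Maybe (Fin n)) x → flip s (flip t x) ≡ flip t (flip s x)
flip-comm nothing        nothing        x       = refl
flip-comm nothing        (just j)       x       = flip-comm-all j x
flip-comm (just i)       nothing        x       = sym (flip-comm-all i x)
flip-comm (just zero)    (just zero)    (a ∷ x) = refl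
flip-comm (just zero)    (just (suc j)) (a ∷ x) = cong (_ ∷_) (flip-comm-all j x)
flip-comm (just (suc i)) (just zero)    (a ∷ x) = cong (_ ∷_) (sym (flip-comm-all i x))
flip-comm (just (suc i)) (just (suc j)) (a ∷ x) = cong (_ ∷_) (flip-comm (just i) (just j) x)

flip-involutive : ∀ {n} (s : Maybe (Fin n)) x → flip s (flip s x) ≡ x
flip-involutive nothing        []      = refl
flip-involutive nothing        (a ∷ x) = cong₂ _∷_ (opposite-involutive a) (flip-involutive nothing x)
flip-involutive (just zero)    (a ∷ x) = cong (a ∷_) (flip-involutive nothing x)
flip-involutive (just (suc i)) (a ∷ x) = cong₂ _∷_ (opposite-involutive a) (flip-involutive (just i) x)

module _ {n : ℕ} where
  open CommutingInvolutions (flip {n}) flip-comm flip-involutive public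

-- Parity of flips and closed walks of odd length.

toggle : ℕ → Fin 2 → Fin 2
toggle zero    a = a
toggle (suc k) a = toggle k (opposite a)

toggle-2+ : ∀ k a → toggle (2 + k) a ≡ toggle k a
toggle-2+ k a = cong (toggle k) (opposite-involutive a)

toggle-even : ∀ k a → toggle (2 * k) a ≡ a
toggle-even zero    a = refl
toggle-even (suc k) a rewrite +-suc k (k + 0) = ≡-trans (toggle-2+ (2 * k) a) (toggle-even k a)

map-toggle-even : ∀ {n} k (x : ℤ₂^ n) → map (toggle (2 * k)) x ≡ x
map-toggle-even k x = ≡-trans (map-cong (toggle-even k) x) (map-id x)

map-toggle-opposite : ∀ {n} k (x : ℤ₂^ n) → map (toggle k) (map opposite x) ≡ map (toggle (suc k)) x
map-toggle-opposite k []      = refl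
map-toggle-opposite k (a ∷ x) = cong (_ ∷_) (map-toggle-opposite k x)

-- Every step sparing a later coordinate flips the head and acts on the tail as a step one dimension
-- lower; this drives the induction on the dimension.
walk-suc : ∀ {n} (w : List (Fin n)) a x →
           walk (a ∷ x) (mapᴸ just (mapᴸ suc w)) ≡ toggle (length w) a ∷ walk x (mapᴸ just w)
walk-suc []      a x = refl
walk-suc (i ∷ w) a x = walk-suc w (opposite a) (flip (just i) x)

allButOne : ∀ n → List (Maybe (Fin n))
allButOne n = mapᴸ just (allFin n)

length-allButOne : ∀ n → length (allButOne n) ≡ n
length-allButOne n = ≡-trans (length-map just (allFin n)) (length-tabulate {n = n} id)

-- Each coordinate is flipped n − 1 times, which has the parity of n + 1.
walk-allButOne : ∀ {n} (x : ℤ₂^ n) → walk x (allButOne n) ≡ map (toggle (suc n)) x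
walk-allButOne {zero}  []      = refl
walk-allButOne {suc n} (a ∷ x) = begin
  -- The first step `just zero` is already performed: it spares `a` and complements the tail to
  -- `x′`.
  walk (a ∷ x′) (mapᴸ just (tabulateᴸ suc))       ≡⟨ cong (walk (a ∷ x′) ∘ mapᴸ just) (map-tabulate id suc) ⟨
  walk (a ∷ x′) (mapᴸ just (mapᴸ suc (allFin n)))          ≡⟨ walk-suc (allFin n) a x′ ⟩
  toggle (length (allFin n)) a ∷ walk x′ (allButOne n)     ≡⟨ cong₂ _∷_ head-eq tail-eq ⟩
  toggle (2 + n) a ∷ map (toggle (2 + n)) x                ∎
  where
  open ≡-Reasoning
  x′ = map opposite x
  head-eq : toggle (length (allFin n)) a ≡ toggle (2 + n) a
  head-eq = ≡-trans (cong (λ k → toggle k a) (length-tabulate {n = n} id)) (sym (toggle-2+ n a))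
  tail-eq : walk x′ (allButOne n) ≡ map (toggle (2 + n)) x
  tail-eq = ≡-trans (walk-allButOne x′) (map-toggle-opposite (suc n) x)

even⊎odd : ∀ n → ∃ (λ k → n ≡ 2 * k) ⊎ ∃ (λ k → n ≡ suc (2 * k))
even⊎odd zero    = inj₁ (0 , refl)
even⊎odd (suc n) with even⊎odd n
... | inj₁ (k , eq) = inj₂ (k , cong suc eq)
... | inj₂ (k , eq) = inj₁ (suc k , cong suc (≡-trans eq (sym (+-suc k (k + 0)))))

no-3-colouring : ∀ {n} (c : ℤ₂^ n → Fin 3) → ¬ (∀ s x → c x ≢ c (flip s x))
no-3-colouring {n} c proper with even⊎odd n
... | inj₁ (k , n≡2k) = even≢odd (ascents x w) k
        (≡-trans (closed-walk-even x w closed) (cong suc (≡-trans (length-allButOne n) n≡2k)))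
  where
  open ThreeColouring c proper
  x = replicate n zero
  -- For even `n` the other steps flip each coordinate an odd number of times; the extra `nothing`
  -- corrects this and makes the length `suc n` odd.
  w = nothing ∷ allButOne n
  closed : walk x w ≡ x
  closed = begin
    walk (map opposite x) (allButOne n)        ≡⟨ walk-allButOne (map opposite x) ⟩
    map (toggle (suc n)) (map opposite x)      ≡⟨ map-toggle-opposite (suc n) x ⟩
    map (toggle (2 + n)) x                     ≡⟨ map-cong (toggle-2+ n) x ⟩
    map (toggle n) x                           ≡⟨ cong (λ m → map (toggle m) x) n≡2k ⟩
    map (toggle (2 * k)) x                     ≡⟨ map-toggle-even k x ⟩
    x                                          ∎
    where open ≡-Reasoning
... | inj₂ (k , n≡1+2k) = even≢odd (ascents x w) k
        (≡-trans (closed-walk-even x w closed) (≡-trans (length-allButOne n) n≡1+2k))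
  where
  open ThreeColouring c proper
  x = replicate n zero
  w = allButOne n
  closed : walk x w ≡ x
  closed = begin
    walk x (allButOne n)          ≡⟨ walk-allButOne x ⟩
    map (toggle (suc n)) x        ≡⟨ cong (λ m → map (toggle (suc m)) x) n≡1+2k ⟩
    map (toggle (2 + 2 * k)) x    ≡⟨ map-cong (toggle-2+ (2 * k)) x ⟩
    map (toggle (2 * k)) x        ≡⟨ map-toggle-even k x ⟩
    x                             ∎
    where open ≡-Reasoning

-- Hamming distance, computed coordinate by coordinate.

-- The indices after the first are tabulated by `suc`; moving `suc` into the predicate turns their
-- count into the distance of the tails.
count-tabulate-∘ : ∀ {A B : Set} {P : B → Set} (P? : Decidable P) (g : A → B) {n} (f : Fin n → A) →
                   count P? (tabulate (g ∘ f)) ≡ count (P? ∘ g) (tabulate f)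
count-tabulate-∘ P? g {zero}  f = refl
count-tabulate-∘ P? g {suc n} f with P? (g (f zero))
... | yes _ = cong suc (count-tabulate-∘ P? g (f ∘ suc))
... | no  _ = count-tabulate-∘ P? g (f ∘ suc)

d-∷-≡ : ∀ {n} {a b} (x y : ℤ₂^ n) → a ≡ b → d (a ∷ x) (b ∷ y) ≡ d x y
d-∷-≡ {a = a} {b} x y a≡b with a ≟ b
... | yes _  = count-tabulate-∘ (λ i → ¬? (lookup (a ∷ x) i ≟ lookup (b ∷ y) i)) suc id
... | no a≢b = contradiction a≡b a≢b

d-∷-≢ : ∀ {n} {a b} (x y : ℤ₂^ n) → a ≢ b → d (a ∷ x) (b ∷ y) ≡ suc (d x y)
d-∷-≢ {a = a} {b} x y a≢b with a ≟ b
... | yes a≡b = contradiction a≡b a≢b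
... | no  _   = cong suc (count-tabulate-∘ (λ i → ¬? (lookup (a ∷ x) i ≟ lookup (b ∷ y) i)) suc id)

d≤n : ∀ {n} (x y : ℤ₂^ n) → d x y ≤ n
d≤n []      []      = z≤n
d≤n (a ∷ x) (b ∷ y) with toSum (a ≟ b)
... | inj₁ a≡b = ≤-trans (≤-reflexive (d-∷-≡ x y a≡b)) (m≤n⇒m≤1+n (d≤n x y))
... | inj₂ a≢b = ≤-trans (≤-reflexive (d-∷-≢ x y a≢b)) (s≤s (d≤n x y))

≢-opposite : ∀ (a : Fin 2) → a ≢ opposite a
≢-opposite zero       ()
≢-opposite (suc zero) ()

d-flip-all : ∀ {n} (x : ℤ₂^ n) → d x (flip nothing x) ≡ n
d-flip-all []      = refl
d-flip-all (a ∷ x) = ≡-trans (d-∷-≢ x _ (≢-opposite a)) (cong suc (d-flip-all x))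

-- The form with `suc` keeps truncated subtraction out of the induction.
d-flip-but : ∀ {n} (i : Fin n) (x : ℤ₂^ n) → suc (d x (flip (just i) x)) ≡ n
d-flip-but zero    (a ∷ x) = cong suc (≡-trans (d-∷-≡ {a = a} x (flip nothing x) refl) (d-flip-all x))
d-flip-but (suc i) (a ∷ x) = cong suc (≡-trans (d-∷-≢ x _ (≢-opposite a)) (d-flip-but i x))

flip-adjacent : ∀ {n} (s : Maybe (Fin n)) x → n ∸ 1 ≤ d x (flip s x)
flip-adjacent {n} nothing  x = ≤-trans (m∸n≤m n 1) (≤-reflexive (sym (d-flip-all x)))
flip-adjacent     (just i) x = ≤-reflexive (cong (_∸ 1) (sym (d-flip-but i x)))

-- The 4-colouring and the chromatic number.

firstTwo : ∀ {n} → ℤ₂^ (2 + n) → Fin 4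
firstTwo (a ∷ b ∷ _) = combine a b

firstTwo-proper : ∀ {n} (x y : ℤ₂^ (2 + n)) → suc n ≤ d x y → firstTwo x ≢ firstTwo y
firstTwo-proper (a ∷ b ∷ x) (a′ ∷ b′ ∷ y) adj eq with combine-injective a b a′ b′ eq
-- Only the `n` coordinates after the first two can differ, one fewer than adjacency demands.
... | a≡a′ , b≡b′ = 1+n≰n (≤-trans adj (≤-trans (≤-reflexive d≡) (d≤n x y)))
  where
  d≡ : d (a ∷ b ∷ x) (a′ ∷ b′ ∷ y) ≡ d x y
  d≡ = ≡-trans (d-∷-≡ (b ∷ x) (b′ ∷ y) a≡a′) (d-∷-≡ x y b≡b′)

Colourable-mono : ∀ {G k m} → k ≤ m → Colourable G k → Colourable G m
Colourable-mono k≤m (c , proper) =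
  (λ x → inject≤ (c x) k≤m) , λ x y adj eq → proper x y adj (inject≤-injective k≤m k≤m (c x) (c y) eq)

theorem3p3 : (n : ℕ) (n≥2 : n ≥ 2) → IsChromaticNumber (H₂ n (n ∸ 1) (n∸1-positive n≥2)) 4
theorem3p3 (suc zero)    (s≤s ())
theorem3p3 (suc (suc n)) n≥2 = (firstTwo , firstTwo-proper) , λ m colourable → ≮⇒≥ λ m<4 →
  -- Fewer than four colours embed into three, so it suffices to exclude colourings in `Fin 3`.
  let c , proper = Colourable-mono {H₂ (2 + n) (suc n) (n∸1-positive n≥2)} (s≤s⁻¹ m<4) colourable
  in  no-3-colouring c λ s x → proper x (flip s x) (flip-adjacent s x)
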